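{- Let $G$ be a connected graph with maximum degree $d$. In the cop and known random killer game on $G$, the cop can win with probability at least $\frac{\sqrt d}{1+\sqrt d}$; that is, there is a starting vertex for the cop such that for every probability distribution $\{p_v\}_{v\in V(G)}$ chosen by the killer, the cop, having learned the distribution before her first move, has a strategy that wins with probability at least $\frac{\sqrt d}{1+\sqrt d}$.
   Context: Graphs are finite, simple and undirected. The cop and random killer game on a connected graph $G$: the cop chooses a starting vertex; then the killer, knowing the cop's starting vertex, chooses a probability distribution $\{p_v\}_{v\in V(G)}$ on the vertices. In the "known" version this distribution is revealed to the cop before her first move. Turns are then numbered $1,2,3,\dots$. On odd turns the cop either stays at her current vertex or moves to an adjacent vertex. On even turns the killer hops to a vertex drawn from $\{p_v\}$, independently of all previous hops (he is at no vertex before his first hop, and his hops are not restricted to edges); the cop sees where he lands. The killer wins if he lands on the cop's current vertex; the cop wins if she is at or moves onto the killer's current vertex on her turn. (So if the killer lands on a neighbour of the cop's vertex, the cop can win on her next turn.) If nobody ever wins, the game is a stalemate. -}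

module Defs where

open import Algebra.Bundles using (CommutativeRing)
open import Data.Bool.Base using (if_then_else_)
open import Data.Fin.Base using (Fin)
open import Data.Fin.Properties using (_≟_)
open import Data.List.Base using (List; []; _∷_; allFin; filter; length; map)
open import Data.List.Extrema.Nat using (max)
open import Data.Nat.Base using (ℕ; zero; suc)
open import Data.Product.Base using (_×_; ∃; _,_; proj₁; proj₂)
open import Data.Sum.Base using (inj₁; inj₂)
open import Data.Vec.Base using (Vec; []; _∷_)
open import Level using (0ℓ)
open import Relation.Binary.Bundles using (Poset)
open import Relation.Binary.Construct.Closure.Reflexive using (ReflClosure)
open import Relation.Binary.Construct.Closure.ReflexiveTransitive using (Star)
open import Relation.Binary.Core using (Rel)
open import Relation.Binary.Definitions using (Decidable; Irreflexive; Symmetric)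
open import Relation.Binary.PropositionalEquality.Core using (_≡_)
open import Relation.Binary.Structures using (IsDecTotalOrder)
open import Relation.Nullary.Decidable.Core using (does; yes; no)
open import Relation.Nullary.Negation.Core using (¬_)
open import Relation.Unary using (Pred)

-- The classical real numbers, given axiomatically (the axioms determine them
-- up to isomorphism).  As usual for a classical field, _⁻¹ and sup are total
-- operations; nothing is assumed about the inverse of zero, nor about the
-- supremum of a set that is empty or unbounded.

record CompleteOrderedField : Set₁ where
  field
    commutativeRing : CommutativeRing 0ℓ 0ℓ

  open CommutativeRing commutativeRing public

  infix 4 _≤_
  infix 8 _⁻¹
  infixl 7 _÷_

  field
    _≤_             : Rel Carrier 0ℓ
    isDecTotalOrder : IsDecTotalOrder _≈_ _≤_
    +-monoʳ-≤       : ∀ z {x y} → x ≤ y → z + x ≤ z + y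
    *-nonNeg        : ∀ {x y} → 0# ≤ x → 0# ≤ y → 0# ≤ x * y
    0≉1             : ¬ 0# ≈ 1#
    _⁻¹             : Carrier → Carrier
    ⁻¹-inverseʳ     : ∀ {x} → ¬ x ≈ 0# → x * x ⁻¹ ≈ 1#

  UpperBound : Pred Carrier 0ℓ → Pred Carrier 0ℓ
  UpperBound S b = ∀ {x} → S x → x ≤ b

  IsLUB : Pred Carrier 0ℓ → Pred Carrier 0ℓ
  IsLUB S s = UpperBound S s × (∀ {b} → UpperBound S b → s ≤ b)

  field
    sup       : Pred Carrier 0ℓ → Carrier
    sup-isLUB : ∀ {S} → ∃ S → ∃ (UpperBound S) → IsLUB S (sup S)

  _÷_ : Carrier → Carrier → Carrier
  x ÷ y = x * y ⁻¹

  -- Meaningful for 0# ≤ x only; see √-nonNeg and √-square below.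
  √ : Carrier → Carrier
  √ x = sup λ y → y * y ≤ x

  open import Algebra.Properties.Semiring.Sum semiring public using (sum)
  open import Algebra.Properties.Semiring.Mult semiring public
    using () renaming (_×_ to _·_)

  fromℕ : ℕ → Carrier
  fromℕ n = n · 1#

module OrderedFieldProperties (R : CompleteOrderedField) where
  open CompleteOrderedField R
  open IsDecTotalOrder isDecTotalOrder public using (isPartialOrder; total; antisym)
    renaming (refl to ≤-refl; trans to ≤-trans; reflexive to ≤-reflexive; _≟_ to _≈?_)
  open import Algebra.Properties.Ring ring using (-‿distribˡ-*; -‿involutive)
  open import Algebra.Solver.Ring.NaturalCoefficients.Default commutativeSemiring
    using (solve; _:=_; _:+_; _:*_; con)

  poset : Poset 0ℓ 0ℓ 0ℓ
  poset = record { isPartialOrder = isPartialOrder }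

  open import Relation.Binary.Reasoning.PartialOrder poset

  x+[y-x]≈y : ∀ x y → x + (y - x) ≈ y
  x+[y-x]≈y x y = begin-equality
    x + (y - x)    ≈⟨ solve 3 (λ x y z → x :+ (y :+ z) := y :+ (x :+ z)) refl x y (- x) ⟩
    y + (x - x)    ≈⟨ +-congˡ (-‿inverseʳ x) ⟩
    y + 0#         ≈⟨ +-identityʳ y ⟩
    y              ∎

  +-cancelˡ-≤ : ∀ z {x y} → z + x ≤ z + y → x ≤ y
  +-cancelˡ-≤ z {x} {y} h = begin
    x              ≈⟨ cancel x ⟨
    - z + (z + x)  ≤⟨ +-monoʳ-≤ (- z) h ⟩
    - z + (z + y)  ≈⟨ cancel y ⟩
    y              ∎
    where
    cancel : ∀ w → - z + (z + w) ≈ w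
    cancel w = trans (sym (+-assoc _ _ _))
                 (trans (+-congʳ (-‿inverseˡ z)) (+-identityˡ w))

  +-mono-≤ : ∀ {a b c d} → a ≤ b → c ≤ d → a + c ≤ b + d
  +-mono-≤ {a} {b} {c} {d} a≤b c≤d = begin
    a + c  ≤⟨ +-monoʳ-≤ a c≤d ⟩
    a + d  ≈⟨ +-comm a d ⟩
    d + a  ≤⟨ +-monoʳ-≤ d a≤b ⟩
    d + b  ≈⟨ +-comm d b ⟩
    b + d  ∎

  x≤x+y : ∀ x {y} → 0# ≤ y → x ≤ x + y
  x≤x+y x {y} 0≤y = begin
    x       ≈⟨ +-identityʳ x ⟨
    x + 0#  ≤⟨ +-monoʳ-≤ x 0≤y ⟩
    x + y   ∎

  +-nonNeg : ∀ {x y} → 0# ≤ x → 0# ≤ y → 0# ≤ x + y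
  +-nonNeg 0≤x 0≤y = ≤-trans 0≤x (x≤x+y _ 0≤y)

  0≤y-x : ∀ {x y} → x ≤ y → 0# ≤ y - x
  0≤y-x {x} {y} x≤y = +-cancelˡ-≤ x (begin
    x + 0#       ≈⟨ +-identityʳ x ⟩
    x            ≤⟨ x≤y ⟩
    y            ≈⟨ x+[y-x]≈y x y ⟨
    x + (y - x)  ∎)

  *-monoʳ-≤ : ∀ z {x y} → 0# ≤ z → x ≤ y → z * x ≤ z * y
  *-monoʳ-≤ z {x} {y} 0≤z x≤y = begin
    z * x                ≤⟨ x≤x+y (z * x) (*-nonNeg 0≤z (0≤y-x x≤y)) ⟩
    z * x + z * (y - x)  ≈⟨ distribˡ z x (y - x) ⟨
    z * (x + (y - x))    ≈⟨ *-congˡ (x+[y-x]≈y x y) ⟩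
    z * y                ∎

  0≤1 : 0# ≤ 1#
  0≤1 with total 0# 1#
  ... | inj₁ 0≤1 = 0≤1
  ... | inj₂ 1≤0 = begin
    0#             ≤⟨ *-nonNeg 0≤-1 0≤-1 ⟩
    - 1# * - 1#    ≈⟨ -‿distribˡ-* 1# (- 1#) ⟨
    - (1# * - 1#)  ≈⟨ -‿cong (*-identityˡ (- 1#)) ⟩
    - - 1#         ≈⟨ -‿involutive 1# ⟩
    1#             ∎
    where
    0≤-1 : 0# ≤ - 1#
    0≤-1 = ≤-trans (0≤y-x 1≤0) (≤-reflexive (+-identityˡ (- 1#)))

  *-cancelʳ-≤ : ∀ k {a b} → 1# ≤ k → a * k ≤ b * k → a ≤ b
  *-cancelʳ-≤ k {a} {b} 1≤k ak≤bk with total a b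
  ... | inj₁ a≤b = a≤b
  ... | inj₂ b≤a = begin
    a            ≈⟨ x+[y-x]≈y b a ⟨
    b + (a - b)  ≤⟨ +-monoʳ-≤ b e≤0 ⟩
    b + 0#       ≈⟨ +-identityʳ b ⟩
    b            ∎
    where
    e : Carrier
    e = a - b
    e≤0 : e ≤ 0#
    e≤0 = +-cancelˡ-≤ (b * k) (begin
      b * k + e       ≈⟨ +-congˡ (*-identityʳ e) ⟨
      b * k + e * 1#  ≤⟨ +-monoʳ-≤ (b * k) (*-monoʳ-≤ e (0≤y-x b≤a) 1≤k) ⟩
      b * k + e * k   ≈⟨ distribʳ k b e ⟨
      (b + e) * k     ≈⟨ *-congʳ (x+[y-x]≈y b a) ⟩
      a * k           ≤⟨ ak≤bk ⟩
      b * k           ≈⟨ +-identityʳ (b * k) ⟨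
      b * k + 0#      ∎)

  square-cancel-≤ : ∀ {y t} → 0# ≤ t → y * y ≤ t * t → y ≤ t
  square-cancel-≤ {y} {t} 0≤t yy≤tt with total y t
  ... | inj₁ y≤t = y≤t
  ... | inj₂ t≤y = begin
    y      ≈⟨ y≈t+e ⟩
    t + e  ≈⟨ +-congˡ e≈0 ⟩
    t + 0# ≈⟨ +-identityʳ t ⟩
    t      ∎
    where
    e : Carrier
    e = y - t
    0≤e : 0# ≤ e
    0≤e = 0≤y-x t≤y
    y≈t+e : y ≈ t + e
    y≈t+e = sym (x+[y-x]≈y t y)
    ee≤0 : e * e ≤ 0#
    ee≤0 = +-cancelˡ-≤ (t * t) (begin
      t * t + e * e                    ≤⟨ x≤x+y _ (+-nonNeg (*-nonNeg 0≤t 0≤e) (*-nonNeg 0≤t 0≤e)) ⟩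
      t * t + e * e + (t * e + t * e)  ≈⟨ solve 2 (λ t e → t :* t :+ e :* e :+ (t :* e :+ t :* e)
                                            := (t :+ e) :* (t :+ e)) refl t e ⟩
      (t + e) * (t + e)                ≈⟨ *-cong y≈t+e y≈t+e ⟨
      y * y                            ≤⟨ yy≤tt ⟩
      t * t                            ≈⟨ +-identityʳ (t * t) ⟨
      t * t + 0#                       ∎)
    ee≈0 : e * e ≈ 0#
    ee≈0 = antisym ee≤0 (*-nonNeg 0≤e 0≤e)
    e≈0 : e ≈ 0#
    e≈0 with e ≈? 0#
    ... | yes e≈0 = e≈0
    ... | no e≉0 = begin-equality
      e               ≈⟨ *-identityʳ e ⟨
      e * 1#          ≈⟨ *-congˡ (⁻¹-inverseʳ e≉0) ⟨
      e * (e * e ⁻¹)  ≈⟨ *-assoc e e (e ⁻¹) ⟨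
      e * e * e ⁻¹    ≈⟨ *-congʳ ee≈0 ⟩
      0# * e ⁻¹       ≈⟨ zeroˡ (e ⁻¹) ⟩
      0#              ∎

  √-isLUB : ∀ {x} → 0# ≤ x → IsLUB (λ y → y * y ≤ x) (√ x)
  √-isLUB {x} 0≤x = sup-isLUB
    (0# , ≤-trans (≤-reflexive (zeroˡ 0#)) 0≤x)
    (1# + x , λ {y} yy≤x → square-cancel-≤ (+-nonNeg 0≤1 0≤x) (begin
      y * y                      ≤⟨ yy≤x ⟩
      x                          ≤⟨ x≤x+y x (+-nonNeg (+-nonNeg 0≤1 0≤x) (*-nonNeg 0≤x 0≤x)) ⟩
      x + (1# + x + x * x)       ≈⟨ solve 1 (λ x → x :+ (con 1 :+ x :+ x :* x)
                                      := (con 1 :+ x) :* (con 1 :+ x)) refl x ⟩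
      (1# + x) * (1# + x)        ∎))

  √-nonNeg : ∀ {x} → 0# ≤ x → 0# ≤ √ x
  √-nonNeg 0≤x = proj₁ (√-isLUB 0≤x) (≤-trans (≤-reflexive (zeroˡ 0#)) 0≤x)

  √-square : ∀ {x} → 0# ≤ x → √ x * √ x ≈ x
  √-square {x} 0≤x = antisym ss≤x x≤ss
    where
    s k : Carrier
    s = √ x
    k = 1# + (s + s + x)

    0≤s : 0# ≤ s
    0≤s = √-nonNeg 0≤x

    1≤k : 1# ≤ k
    1≤k = x≤x+y 1# (+-nonNeg (+-nonNeg 0≤s 0≤s) 0≤x)

    k≉0 : ¬ k ≈ 0#
    k≉0 k≈0 = 0≉1 (antisym 0≤1 (≤-trans 1≤k (≤-reflexive k≈0)))

    ÷k*k : ∀ z → (z ÷ k) * k ≈ z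
    ÷k*k z = begin-equality
      z * k ⁻¹ * k    ≈⟨ *-assoc z (k ⁻¹) k ⟩
      z * (k ⁻¹ * k)  ≈⟨ *-congˡ (trans (*-comm (k ⁻¹) k) (⁻¹-inverseʳ k≉0)) ⟩
      z * 1#          ≈⟨ *-identityʳ z ⟩
      z               ∎

    ÷k-nonNeg : ∀ {z} → 0# ≤ z → 0# ≤ z ÷ k
    ÷k-nonNeg {z} 0≤z = *-cancelʳ-≤ k 1≤k (begin
      0# * k       ≈⟨ zeroˡ k ⟩
      0#           ≤⟨ 0≤z ⟩
      z            ≈⟨ ÷k*k z ⟨
      (z ÷ k) * k  ∎)

    2s≤k : s + s ≤ k
    2s≤k = begin
      s + s              ≤⟨ x≤x+y (s + s) (+-nonNeg 0≤1 0≤x) ⟩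
      s + s + (1# + x)   ≈⟨ solve 2 (λ s x → s :+ s :+ (con 1 :+ x)
                              := con 1 :+ (s :+ s :+ x)) refl s x ⟩
      k                  ∎

    -- Otherwise √ x - (√ x * √ x - x) ÷ k is a smaller upper bound.
    ss≤x : s * s ≤ x
    ss≤x with total (s * s) x
    ... | inj₁ ss≤x = ss≤x
    ... | inj₂ x≤ss = begin
      s * s          ≈⟨ x+d≈ss ⟨
      x + d          ≈⟨ +-congˡ (÷k*k d) ⟨
      x + δ * k      ≈⟨ +-congˡ (*-congʳ δ≈0) ⟩
      x + 0# * k     ≈⟨ +-congˡ (zeroˡ k) ⟩
      x + 0#         ≈⟨ +-identityʳ x ⟩
      x              ∎
      where
      d δ t : Carrier
      d = s * s - x
      δ = d ÷ k
      t = s - δ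

      x+d≈ss : x + d ≈ s * s
      x+d≈ss = x+[y-x]≈y x (s * s)

      0≤d : 0# ≤ d
      0≤d = 0≤y-x x≤ss

      0≤δ : 0# ≤ δ
      0≤δ = ÷k-nonNeg 0≤d

      δ≤s : δ ≤ s
      δ≤s = *-cancelʳ-≤ k 1≤k (begin
        δ * k      ≈⟨ ÷k*k d ⟩
        d          ≤⟨ x≤x+y d 0≤x ⟩
        d + x      ≈⟨ trans (+-comm d x) x+d≈ss ⟩
        s * s      ≤⟨ *-monoʳ-≤ s 0≤s (≤-trans (x≤x+y s 0≤s) 2s≤k) ⟩
        s * k      ∎)

      0≤t : 0# ≤ t
      0≤t = 0≤y-x δ≤s

      δ+t≈s : δ + t ≈ s
      δ+t≈s = x+[y-x]≈y δ s

      x≤tt : x ≤ t * t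
      x≤tt = +-cancelˡ-≤ d (begin
        d + x                          ≈⟨ trans (+-comm d x) x+d≈ss ⟩
        s * s                          ≈⟨ *-cong δ+t≈s δ+t≈s ⟨
        (δ + t) * (δ + t)              ≤⟨ x≤x+y _ (*-nonNeg 0≤δ 0≤δ) ⟩
        (δ + t) * (δ + t) + δ * δ      ≈⟨ solve 2 (λ δ t → (δ :+ t) :* (δ :+ t) :+ δ :* δ
                                            := δ :* ((δ :+ t) :+ (δ :+ t)) :+ t :* t) refl δ t ⟩
        δ * ((δ + t) + (δ + t)) + t * t ≈⟨ +-congʳ (*-congˡ (+-cong δ+t≈s δ+t≈s)) ⟩
        δ * (s + s) + t * t            ≈⟨ +-comm _ _ ⟩
        t * t + δ * (s + s)            ≤⟨ +-monoʳ-≤ (t * t) (*-monoʳ-≤ δ 0≤δ 2s≤k) ⟩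
        t * t + δ * k                  ≈⟨ +-comm _ _ ⟩
        δ * k + t * t                  ≈⟨ +-congʳ (÷k*k d) ⟩
        d + t * t                      ∎)

      s≤t : s ≤ t
      s≤t = proj₂ (√-isLUB 0≤x) λ yy≤x → square-cancel-≤ 0≤t (≤-trans yy≤x x≤tt)

      δ≈0 : δ ≈ 0#
      δ≈0 = antisym (+-cancelˡ-≤ t (begin
        t + δ   ≈⟨ trans (+-comm t δ) δ+t≈s ⟩
        s       ≤⟨ s≤t ⟩
        t       ≈⟨ +-identityʳ t ⟨
        t + 0#  ∎)) 0≤δ

    -- Otherwise √ x + (x - √ x * √ x) ÷ k is a larger element of the set.
    x≤ss : x ≤ s * s
    x≤ss with total x (s * s)
    ... | inj₁ x≤ss = x≤ss
    ... | inj₂ ss≤x' = begin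
      x               ≈⟨ ss+d≈x ⟨
      s * s + d       ≈⟨ +-congˡ (÷k*k d) ⟨
      s * s + ε * k   ≈⟨ +-congˡ (*-congʳ ε≈0) ⟩
      s * s + 0# * k  ≈⟨ +-congˡ (zeroˡ k) ⟩
      s * s + 0#      ≈⟨ +-identityʳ (s * s) ⟩
      s * s           ∎
      where
      d ε : Carrier
      d = x - s * s
      ε = d ÷ k

      ss+d≈x : s * s + d ≈ x
      ss+d≈x = x+[y-x]≈y (s * s) x

      0≤ε : 0# ≤ ε
      0≤ε = ÷k-nonNeg (0≤y-x ss≤x')

      ε≤1 : ε ≤ 1#
      ε≤1 = *-cancelʳ-≤ k 1≤k (begin
        ε * k              ≈⟨ ÷k*k d ⟩
        d                  ≤⟨ x≤x+y d (*-nonNeg 0≤s 0≤s) ⟩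
        d + s * s          ≈⟨ trans (+-comm d (s * s)) ss+d≈x ⟩
        x                  ≤⟨ x≤x+y x (+-nonNeg 0≤1 (+-nonNeg 0≤s 0≤s)) ⟩
        x + (1# + (s + s)) ≈⟨ solve 2 (λ s x → x :+ (con 1 :+ (s :+ s))
                                := con 1 :* (con 1 :+ (s :+ s :+ x))) refl s x ⟩
        1# * k             ∎)

      ε+2s≤k : ε + (s + s) ≤ k
      ε+2s≤k = begin
        ε + (s + s)   ≤⟨ +-mono-≤ ε≤1 (x≤x+y (s + s) 0≤x) ⟩
        k             ∎

      s+ε≤s : s + ε ≤ s
      s+ε≤s = proj₁ (√-isLUB 0≤x) (begin
        (s + ε) * (s + ε)          ≈⟨ solve 2 (λ s ε → (s :+ ε) :* (s :+ ε)
                                        := s :* s :+ ε :* (ε :+ (s :+ s))) refl s ε ⟩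
        s * s + ε * (ε + (s + s))  ≤⟨ +-monoʳ-≤ (s * s) (*-monoʳ-≤ ε 0≤ε ε+2s≤k) ⟩
        s * s + ε * k              ≈⟨ +-congˡ (÷k*k d) ⟩
        s * s + d                  ≈⟨ ss+d≈x ⟩
        x                          ∎)

      ε≈0 : ε ≈ 0#
      ε≈0 = antisym (+-cancelˡ-≤ s (≤-trans s+ε≤s (≤-reflexive (sym (+-identityʳ s))))) 0≤ε

record Graph : Set₁ where
  field
    order : ℕ

  Vertex : Set
  Vertex = Fin order

  field
    Adj       : Rel Vertex 0ℓ
    adjacent? : Decidable Adj
    symmetric : Symmetric Adj
    loopless  : Irreflexive _≡_ Adj

  degree : Vertex → ℕ
  degree v = length (filter (adjacent? v) (allFin order))

  maxDegree : ℕ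
  maxDegree = max 0 (map degree (allFin order))

  -- The empty graph is not connected.
  Connected : Set
  Connected = Vertex × (∀ u v → Star Adj u v)

data Outcome : Set where
  copWins killerWins undecided : Outcome

module Game (R : CompleteOrderedField) (G : Graph) where
  open CompleteOrderedField R
  open Graph G

  record Distribution : Set where
    field
      mass        : Vertex → Carrier
      mass-nonNeg : ∀ v → 0# ≤ mass v
      mass-total  : sum mass ≈ 1#

  -- The killer's landing vertices so far, most recent first.
  History : Set
  History = List Vertex

  -- position h is the cop's vertex after the turn she takes having seen h.
  -- In particular position [] is her vertex after turn 1.
  record Strategy (start : Vertex) : Set where
    field
      position   : History → Vertex
      first-move : ReflClosure Adj start (position [])
      next-move  : ∀ k h → ReflClosure Adj (position h) (position (k ∷ h))

  module _ {start : Vertex} (σ : Strategy start) where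
    open Strategy σ

    -- The outcome when, after history h and the cop's reply to it, the killer's
    -- next hops are the given ones, the cop replying to each (including the last).
    play : ∀ {n} → History → Vec Vertex n → Outcome
    play h []       = undecided
    play h (k ∷ ks) =
      if does (k ≟ position h) then killerWins
      else if does (position (k ∷ h) ≟ k) then copWins
      else play (k ∷ h) ks

  copWinIndicator : Outcome → Carrier
  copWinIndicator copWins    = 1#
  copWinIndicator killerWins = 0#
  copWinIndicator undecided  = 0#

  module _ (p : Distribution) where
    open Distribution p

    -- Expectation over n independent hops: the sum over all sequences of hops
    -- of the product of their masses times f.
    expectation : ∀ n → (Vec Vertex n → Carrier) → Carrier
    expectation zero    f = f []
    expectation (suc n) f = sum λ v → mass v * expectation n (λ ks → f (v ∷ ks))

    winWithin : ∀ {start} → Strategy start → ℕ → Carrier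
    winWithin σ n = expectation n λ ks → copWinIndicator (play σ [] ks)

    -- The cop wins iff she wins within some finite number of hops.  These events
    -- increase with n, so the probability of their union is the supremum.
    winProbability : ∀ {start} → Strategy start → Carrier
    winProbability σ = sup λ x → ∃ λ n → x ≈ winWithin σ n

{-# OPTIONS --safe #-}
module Submission where

-- Write r for the square root of the maximum degree, and call a vertex safe if r times its mass
-- is at most the mass of its neighbourhood: on a hop while the cop stands there, her odds of
-- winning against losing are at least r : 1.  A cop who visits only safe vertices, and ends
-- waiting at one whose closed neighbourhood has positive mass, wins with probability at least
-- r ÷ (1 + r).
--
-- Let the cop start at a vertex s of maximum degree.  If some neighbour w of s has r times its
-- mass at most that of s, then w is safe; otherwise averaging over the r * r neighbours of s
-- shows that s is safe.  From a safe vertex the cop walks towards a vertex of positive mass and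
-- stops as soon as her closed neighbourhood has positive mass.

open import Defs
open import Data.Bool.Base using (if_then_else_)
open import Data.Empty using (⊥-elim)
open import Data.Fin.Base using (Fin; zero; suc)
open import Data.Fin.Properties using (_≟_; any?)
open import Data.List.Base using ([]; _∷_; allFin; filter; length; map; tabulate)
open import Data.List.Extrema.Nat using (argmax-sel; xs≤max)
open import Data.List.Membership.Propositional.Properties using (∈-map⁻; ∈-map⁺; ∈-allFin)
import Data.List.Relation.Unary.All as All
open import Data.Nat.Base as ℕ using (ℕ; zero; suc)
open import Data.Nat.Properties using (n≤0⇒n≡0)
open import Data.Product.Base using (_×_; ∃; _,_; proj₁; proj₂)
open import Data.Sum.Base using (inj₁; inj₂)
open import Data.Vec.Base using (_∷_)
open import Function.Base using (_∘_; id)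
open import Level using (0ℓ)
open import Relation.Binary.Construct.Closure.Reflexive using (ReflClosure; refl; [_])
open import Relation.Binary.Construct.Closure.ReflexiveTransitive using (Star; ε; _◅_)
import Relation.Binary.PropositionalEquality.Core as ≡
open import Relation.Binary.Structures using (IsDecTotalOrder)
open import Relation.Nullary.Decidable.Core using (does; yes; no; ¬?; _×-dec_)
open import Relation.Nullary.Negation.Core using (¬_)
import Relation.Unary as U

-- Ordered fields: cancellation, suprema and finite sums.

module OrderedField (R : CompleteOrderedField) where
  open CompleteOrderedField R hiding (zero) renaming (refl to ≈-refl)
  open OrderedFieldProperties R
  open import Algebra.Properties.CommutativeMonoid.Sum +-commutativeMonoid
    using (sum-cong-≋; sum-replicate-zero)
  open import Relation.Binary.Reasoning.PartialOrder poset

  *-monoˡ-≤ : ∀ z {x y} → 0# ≤ z → x ≤ y → x * z ≤ y * z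
  *-monoˡ-≤ z {x} {y} 0≤z x≤y = begin
    x * z  ≈⟨ *-comm x z ⟩
    z * x  ≤⟨ *-monoʳ-≤ z 0≤z x≤y ⟩
    z * y  ≈⟨ *-comm z y ⟩
    y * z  ∎

  ÷-cancelʳ : ∀ {k} x → ¬ k ≈ 0# → (x ÷ k) * k ≈ x
  ÷-cancelʳ {k} x k≉0 = begin-equality
    x * k ⁻¹ * k    ≈⟨ *-assoc x (k ⁻¹) k ⟩
    x * (k ⁻¹ * k)  ≈⟨ *-congˡ (trans (*-comm (k ⁻¹) k) (⁻¹-inverseʳ k≉0)) ⟩
    x * 1#          ≈⟨ *-identityʳ x ⟩
    x               ∎

  *-cancelʳ-≈ : ∀ {k a b} → ¬ k ≈ 0# → a * k ≈ b * k → a ≈ b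
  *-cancelʳ-≈ {k} {a} {b} k≉0 ak≈bk = begin-equality
    a               ≈⟨ *-identityʳ a ⟨
    a * 1#          ≈⟨ *-congˡ (⁻¹-inverseʳ k≉0) ⟨
    a * (k * k ⁻¹)  ≈⟨ *-assoc a k (k ⁻¹) ⟨
    a * k * k ⁻¹    ≈⟨ *-congʳ ak≈bk ⟩
    b * k * k ⁻¹    ≈⟨ *-assoc b k (k ⁻¹) ⟩
    b * (k * k ⁻¹)  ≈⟨ *-congˡ (⁻¹-inverseʳ k≉0) ⟩
    b * 1#          ≈⟨ *-identityʳ b ⟩
    b               ∎

  *-cancelʳ-≤-nonNeg : ∀ {k a b} → 0# ≤ k → ¬ k ≈ 0# → a * k ≤ b * k → a ≤ b
  *-cancelʳ-≤-nonNeg {k} {a} {b} 0≤k k≉0 ak≤bk with total a b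
  ... | inj₁ a≤b = a≤b
  ... | inj₂ b≤a =
    ≤-reflexive (*-cancelʳ-≈ k≉0 (antisym ak≤bk (*-monoˡ-≤ k 0≤k b≤a)))

  -- Carries a bound valid at every finite horizon over to the limit. For nonzero `q` the bound
  -- makes `(x - a) ÷ q` an upper bound of `S`; for `q ≈ 0#` both sides collapse to `a`, and any
  -- member of `S` gives the claim.
  affine-sup : ∀ {S : U.Pred Carrier 0ℓ} {a q b x} → IsLUB S b → ∃ S → 0# ≤ q →
    (∀ {y} → S y → a + q * y ≤ x) → a + q * b ≤ x
  affine-sup {a = a} {q} {b} {x} (_ , least) (y , y∈S) 0≤q bound with q ≈? 0#
  ... | yes q≈0 = begin
    a + q * b  ≈⟨ +-congˡ (q*z≈0 b) ⟩
    a + 0#     ≈⟨ +-congˡ (q*z≈0 y) ⟨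
    a + q * y  ≤⟨ bound y∈S ⟩
    x          ∎
    where
    q*z≈0 : ∀ z → q * z ≈ 0#
    q*z≈0 z = trans (*-congʳ q≈0) (zeroˡ z)
  ... | no q≉0 = begin
    a + q * b              ≤⟨ +-monoʳ-≤ a (*-monoʳ-≤ q 0≤q (least upper)) ⟩
    a + q * ((x - a) ÷ q)  ≈⟨ +-congˡ q*quotient ⟩
    a + (x - a)            ≈⟨ x+[y-x]≈y a x ⟩
    x                      ∎
    where
    q*quotient : q * ((x - a) ÷ q) ≈ x - a
    q*quotient = trans (*-comm q _) (÷-cancelʳ (x - a) q≉0)
    upper : UpperBound _ ((x - a) ÷ q)
    upper {y} y∈S = *-cancelʳ-≤-nonNeg 0≤q q≉0 (+-cancelˡ-≤ a (begin
      a + y * q              ≈⟨ +-congˡ (*-comm y q) ⟩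
      a + q * y              ≤⟨ bound y∈S ⟩
      x                      ≈⟨ x+[y-x]≈y a x ⟨
      a + (x - a)            ≈⟨ +-congˡ (÷-cancelʳ (x - a) q≉0) ⟨
      a + ((x - a) ÷ q) * q  ∎))

  fromℕ-nonNeg : ∀ n → 0# ≤ fromℕ n
  fromℕ-nonNeg zero    = ≤-refl
  fromℕ-nonNeg (suc n) = +-nonNeg 0≤1 (fromℕ-nonNeg n)

  sum-mono-≤ : ∀ {n} {f g : Fin n → Carrier} → (∀ i → f i ≤ g i) → sum f ≤ sum g
  sum-mono-≤ {zero}  f≤g = ≤-refl
  sum-mono-≤ {suc n} f≤g = +-mono-≤ (f≤g zero) (sum-mono-≤ (f≤g ∘ suc))

  sum-zero : ∀ {n} {f : Fin n → Carrier} → (∀ i → f i ≈ 0#) → sum f ≈ 0#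
  sum-zero {n} f≈0 = trans (sum-cong-≋ f≈0) (sum-replicate-zero n)

  sum-nonNeg : ∀ {n} {f : Fin n → Carrier} → (∀ i → 0# ≤ f i) → 0# ≤ sum f
  sum-nonNeg {n} {f} 0≤f = begin
    0#                    ≈⟨ sum-replicate-zero n ⟨
    sum {n} (λ _ → 0#)    ≤⟨ sum-mono-≤ 0≤f ⟩
    sum f                 ∎

  sum-single : ∀ {n} (f : Fin n → Carrier) i →
    sum (λ j → if does (j ≟ i) then f j else 0#) ≈ f i
  sum-single {suc n} f zero = trans (+-congˡ (sum-zero {n} λ _ → ≈-refl)) (+-identityʳ (f zero))
  sum-single f (suc i) = trans (+-identityˡ _) (sum-single (f ∘ suc) i)

  -- Turns a degree into a sum over vertices that can be compared termwise. The general `f` lets the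
  -- induction pass to `f ∘ suc`; `allFin` is the case `f = id`.
  fromℕ-length-filter : ∀ {n} {A : Set} {P : U.Pred A 0ℓ} (P? : U.Decidable P)
    (f : Fin n → A) x →
    fromℕ (length (filter P? (tabulate f))) * x ≈ sum (λ i → if does (P? (f i)) then x else 0#)
  fromℕ-length-filter {zero}  P? f x = zeroˡ x
  fromℕ-length-filter {suc n} P? f x with P? (f zero)
  ... | no  _ = trans (fromℕ-length-filter P? (f ∘ suc) x) (sym (+-identityˡ _))
  ... | yes _ = trans (distribʳ x 1# _)
    (+-cong (*-identityˡ x) (fromℕ-length-filter P? (f ∘ suc) x))

-- A vertex of maximum degree.

module _ (G : Graph) where
  open Graph G

  maxDegree-attained : Vertex → ∃ λ s → degree s ≡.≡ maxDegree
  maxDegree-attained v with argmax-sel id 0 (map degree (allFin order))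
  ... | inj₂ max∈ with ∈-map⁻ degree max∈
  ...   | s , _ , max≡ = s , ≡.sym max≡
  -- Here the maximum is the default 0 of `max`, so every degree is 0 and any vertex attains it.
  maxDegree-attained v | inj₁ max≡0 = v , ≡.trans (n≤0⇒n≡0 degree≤0) (≡.sym max≡0)
    where
    degree≤0 = ≡.subst (degree v ℕ.≤_) max≡0
      (All.lookup (xs≤max 0 (map degree (allFin order))) (∈-map⁺ degree (∈-allFin v)))

module Hunt (R : CompleteOrderedField) (G : Graph)
            (p : Game.Distribution R G) where
  open CompleteOrderedField R hiding (zero) renaming (refl to ≈-refl)
  open IsDecTotalOrder isDecTotalOrder using (_≤?_)
  open OrderedFieldProperties R
  open OrderedField R
  open Graph G
  open Game R G
  open Distribution p
  open import Algebra.Properties.CommutativeMonoid.Sum +-commutativeMonoid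
    using (sum-cong-≋; ∑-distrib-+)
  open import Algebra.Properties.Semiring.Sum semiring using (*-distribˡ-sum; *-distribʳ-sum)
  open import Algebra.Solver.Ring.NaturalCoefficients.Default commutativeSemiring
    using (solve; _:=_; _:+_; _:*_; con)
  open import Relation.Binary.Reasoning.PartialOrder poset

  -- Splitting the mass as seen from the cop's vertex.

  -- A near hop lets the cop capture at once, and after a far hop the game goes on; only a hop onto
  -- `v` itself is lost.
  nearMass farMass : Vertex → Vertex → Carrier
  nearMass v k = if does (adjacent? v k) then mass k else 0#
  farMass v k = if does (k ≟ v) then 0# else if does (adjacent? v k) then 0# else mass k

  near far closed : Vertex → Carrier
  near v = sum (nearMass v)
  far v = sum (farMass v)
  closed v = mass v + near v

  near-nonNeg : ∀ v → 0# ≤ near v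
  near-nonNeg v = sum-nonNeg term
    where
    term : ∀ k → 0# ≤ nearMass v k
    term k with adjacent? v k
    ... | yes _ = mass-nonNeg k
    ... | no  _ = ≤-refl

  far-nonNeg : ∀ v → 0# ≤ far v
  far-nonNeg v = sum-nonNeg term
    where
    term : ∀ k → 0# ≤ farMass v k
    term k with k ≟ v | adjacent? v k
    ... | yes _ | _     = ≤-refl
    ... | no  _ | yes _ = ≤-refl
    ... | no  _ | no  _ = mass-nonNeg k

  closed-nonNeg : ∀ v → 0# ≤ closed v
  closed-nonNeg v = +-nonNeg (mass-nonNeg v) (near-nonNeg v)

  closed+far≈1 : ∀ v → closed v + far v ≈ 1#
  closed+far≈1 v = begin-equality
    closed v + far v                           ≈⟨ +-congʳ (+-congʳ (sum-single mass v)) ⟨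
    sum own + near v + far v                   ≈⟨ +-congʳ (∑-distrib-+ own (nearMass v)) ⟨
    sum (λ k → own k + nearMass v k) + far v   ≈⟨ ∑-distrib-+ (λ k → own k + nearMass v k) (farMass v) ⟨
    sum (λ k → own k + nearMass v k + farMass v k)  ≈⟨ sum-cong-≋ term ⟩
    sum mass                                   ≈⟨ mass-total ⟩
    1#                                         ∎
    where
    own : Vertex → Carrier
    own k = if does (k ≟ v) then mass k else 0#
    term : ∀ k → own k + nearMass v k + farMass v k ≈ mass k
    term k with k ≟ v | adjacent? v k
    ... | yes k≡v | yes e = ⊥-elim (loopless (≡.sym k≡v) e)
    ... | yes _   | no  _ = trans (+-identityʳ _) (+-identityʳ _)
    ... | no  _   | yes _ = trans (+-identityʳ _) (+-identityˡ _)
    ... | no  _   | no  _ = trans (+-congʳ (+-identityʳ 0#)) (+-identityˡ _)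

  mass≤near : ∀ {u v} → Adj v u → mass u ≤ near v
  mass≤near {u} {v} e = begin
    mass u                                          ≈⟨ sum-single mass u ⟨
    sum (λ k → if does (k ≟ u) then mass k else 0#)  ≤⟨ sum-mono-≤ term ⟩
    near v                                          ∎
    where
    term : ∀ k → (if does (k ≟ u) then mass k else 0#) ≤ nearMass v k
    term k with k ≟ u | adjacent? v k
    ... | yes ≡.refl | yes _ = ≤-refl
    ... | yes ≡.refl | no ¬e = ⊥-elim (¬e e)
    ... | no  _      | yes _ = mass-nonNeg k
    ... | no  _      | no  _ = ≤-refl

  massive-vertex : ∃ λ z → ¬ mass z ≈ 0#
  massive-vertex with any? (λ z → ¬? (mass z ≈? 0#))
  ... | yes found = found
  ... | no none = ⊥-elim (0≉1 (trans (sym (sum-zero massless)) mass-total))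
    where
    massless : ∀ z → mass z ≈ 0#
    massless z with mass z ≈? 0#
    ... | yes z≈0 = z≈0
    ... | no  z≉0 = ⊥-elim (none (z , z≉0))

  expectation-const : ∀ n x → expectation p n (λ _ → x) ≈ x
  expectation-const zero    x = ≈-refl
  expectation-const (suc n) x = begin-equality
    sum (λ v → mass v * expectation p n (λ _ → x))  ≈⟨ sum-cong-≋ (λ v → *-congˡ {mass v} (expectation-const n x)) ⟩
    sum (λ v → mass v * x)                          ≈⟨ *-distribʳ-sum x mass ⟨
    sum mass * x                                    ≈⟨ *-congʳ mass-total ⟩
    1# * x                                          ≈⟨ *-identityˡ x ⟩
    x                                               ∎

  -- Strategies that follow a walk.

  -- Only the first vertex is an index, so the walk still ahead, packed with its first vertex,
  -- serves as the cop's state.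
  data Walk : Vertex → Set where
    stay : ∀ {v} → Walk v
    move : ∀ {u v} → Adj v u → Walk u → Walk v

  advance : ∃ Walk → ∃ Walk
  advance (v , stay)     = v , stay
  advance (_ , move _ w) = _ , w

  advance-edge : ∀ s → ReflClosure Adj (proj₁ s) (proj₁ (advance s))
  advance-edge (_ , stay)     = refl
  advance-edge (_ , move e _) = [ e ]

  -- Moving onto an adjacent killer ends the game, so the `stay` that follows is an arbitrary
  -- continuation.
  respond : ∃ Walk → Vertex → ∃ Walk
  respond s k with adjacent? (proj₁ s) k
  ... | yes _ = k , stay
  ... | no  _ = advance s

  respond-edge : ∀ s k → ReflClosure Adj (proj₁ s) (proj₁ (respond s k))
  respond-edge s k with adjacent? (proj₁ s) k
  ... | yes e = [ e ]
  ... | no  _ = advance-edge s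

  module _ {start g : Vertex} (first : ReflClosure Adj start g) (w : Walk g) where

    state : History → ∃ Walk
    state []      = g , w
    state (k ∷ h) = respond (state h) k

    hunt : Strategy start
    hunt = record
      { position   = proj₁ ∘ state
      ; first-move = first
      ; next-move  = λ k h → respond-edge (state h) k
      }

  -- Winning chances at finite horizons and in the limit.

  winChance : ℕ → ∃ Walk → Carrier
  winChance zero    _ = 0#
  winChance (suc n) s = near (proj₁ s) + far (proj₁ s) * winChance n (advance s)

  -- While the game is undecided, its future depends on the history only through the cop's state. An
  -- arbitrary `h` is needed for the induction on `n`.
  expectation-hunt : ∀ {start g} (first : ReflClosure Adj start g) (w : Walk g) n h →
    expectation p n (λ ks → copWinIndicator (play (hunt first w) h ks))
      ≈ winChance n (state first w h)
  expectation-hunt first w zero    h = ≈-refl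
  expectation-hunt first w (suc n) h = begin-equality
    sum (λ k → mass k * E k)                      ≈⟨ sum-cong-≋ term ⟩
    sum (λ k → nearMass v k + farMass v k * W)  ≈⟨ ∑-distrib-+ (nearMass v) _ ⟩
    near v + sum (λ k → farMass v k * W)          ≈⟨ +-congˡ (*-distribʳ-sum W (farMass v)) ⟨
    near v + far v * W                            ∎
    where
    s = state first w h
    v = proj₁ s
    W = winChance n (advance s)
    E : Vertex → Carrier
    E k = expectation p n (λ ks → copWinIndicator (play (hunt first w) h (k ∷ ks)))
    IH : ∀ k → expectation p n (λ ks → copWinIndicator (play (hunt first w) (k ∷ h) ks))
      ≈ winChance n (respond s k)
    IH k = expectation-hunt first w n (k ∷ h)
    reached : ∀ {k} → ReflClosure Adj v k → ¬ k ≡.≡ v → Adj v k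
    reached refl  k≢v = ⊥-elim (k≢v ≡.refl)
    reached [ e ] _   = e
    term : ∀ k → mass k * E k ≈ nearMass v k + farMass v k * W
    -- `IH k` is abstracted too, so that `respond` in its type reduces along with the adjacency
    -- test.
    term k with k ≟ v | adjacent? v k | IH k
    ... | yes k≡v | yes e | _ = ⊥-elim (loopless (≡.sym k≡v) e)
    ... | yes _   | no  _ | _ = begin-equality
      mass k * expectation p n (λ _ → 0#)  ≈⟨ *-congˡ (expectation-const n 0#) ⟩
      mass k * 0#                          ≈⟨ solve 2 (λ m w → m :* con 0 := con 0 :+ con 0 :* w) ≈-refl (mass k) W ⟩
      0# + 0# * W                          ∎
    -- The cop's reply is `k` itself, so the capture test in `play` has become `k ≟ k`.
    ... | no  _   | yes _ | _ with k ≟ k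
    ...   | no k≢k = ⊥-elim (k≢k ≡.refl)
    ...   | yes _ = begin-equality
      mass k * expectation p n (λ _ → 1#)  ≈⟨ *-congˡ (expectation-const n 1#) ⟩
      mass k * 1#                          ≈⟨ solve 2 (λ m w → m :* con 1 := m :+ con 0 :* w) ≈-refl (mass k) W ⟩
      mass k + 0# * W                      ∎
    term k | no k≢v | no ¬e | IH′ with proj₁ (advance s) ≟ k
    -- Advancing reaches only `v` or a neighbour of it, so it cannot catch a killer who landed far
    -- away.
    ...   | yes ≡.refl = ⊥-elim (¬e (reached (advance-edge s) k≢v))
    ...   | no  _ = trans (*-congˡ IH′) (sym (+-identityˡ _))

  winChance≤1 : ∀ n s → winChance n s ≤ 1#
  winChance≤1 zero    s = 0≤1
  winChance≤1 (suc n) s = begin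
    near v + far v * winChance n (advance s)  ≤⟨ +-monoʳ-≤ (near v) (*-monoʳ-≤ (far v) (far-nonNeg v) (winChance≤1 n (advance s))) ⟩
    near v + far v * 1#                       ≈⟨ +-congˡ (*-identityʳ (far v)) ⟩
    near v + far v                            ≤⟨ x≤x+y _ (mass-nonNeg v) ⟩
    near v + far v + mass v                   ≈⟨ solve 3 (λ m a q → a :+ q :+ m := m :+ a :+ q) ≈-refl (mass v) (near v) (far v) ⟩
    closed v + far v                          ≈⟨ closed+far≈1 v ⟩
    1#                                        ∎
    where v = proj₁ s

  value : ∃ Walk → Carrier
  value s = sup λ x → ∃ λ n → x ≈ winChance n s

  value-isLUB : ∀ s → IsLUB (λ x → ∃ λ n → x ≈ winChance n s) (value s)
  value-isLUB s = sup-isLUB (0# , 0 , ≈-refl)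
    (1# , λ (n , x≈) → ≤-trans (≤-reflexive x≈) (winChance≤1 n s))

  -- Prefixing one hop turns horizon `n` from `advance s` into horizon `suc n` from `s`;
  -- `affine-sup` then passes to the supremum.
  value-step : ∀ s → near (proj₁ s) + far (proj₁ s) * value (advance s) ≤ value s
  value-step s = affine-sup (value-isLUB (advance s)) (0# , 0 , ≈-refl) (far-nonNeg _)
    λ (n , x≈) → proj₁ (value-isLUB s) (suc n , +-congˡ (*-congˡ x≈))

  value≤winProbability : ∀ {start g} (first : ReflClosure Adj start g) (w : Walk g) →
    value (g , w) ≤ winProbability p (hunt first w)
  value≤winProbability {g = g} first w =
    proj₂ (value-isLUB (g , w)) λ (n , x≈) →
      proj₁ winProbability-isLUB (n , trans x≈ (sym (expectation-hunt first w n [])))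
    where
    winProbability-isLUB = sup-isLUB
      {λ x → ∃ λ n → x ≈ winWithin p (hunt first w) n}
      (0# , 0 , ≈-refl)
      (1# , λ (n , x≈) → ≤-trans
        (≤-reflexive (trans x≈ (expectation-hunt first w n []))) (winChance≤1 n (g , w)))

  -- Safe walks and the bound `r ÷ (1# + r)`.

  module _ (r : Carrier) (0≤r : 0# ≤ r) where

    Safe : Vertex → Set
    Safe v = r * mass v ≤ near v

    data SafeWalk : ∀ {v} → Walk v → Set where
      stay : ∀ {v} → Safe v → ¬ closed v ≈ 0# → SafeWalk {v} stay
      move : ∀ {u v} {w : Walk u} {e : Adj v u} → Safe v → SafeWalk w → SafeWalk (move e w)

    private
      1≤1+r : 1# ≤ 1# + r
      1≤1+r = x≤x+y 1# 0≤r

      1+r≉0 : ¬ 1# + r ≈ 0#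
      1+r≉0 1+r≈0 = 0≉1 (antisym 0≤1 (≤-trans 1≤1+r (≤-reflexive 1+r≈0)))

      c : Carrier
      c = r ÷ (1# + r)

    -- Given that a hop decides the game, odds of at least r : 1 mean a winning share of at least
    -- `c`.
    c*closed≤near : ∀ {v} → Safe v → c * closed v ≤ near v
    c*closed≤near {v} safe = *-cancelʳ-≤ (1# + r) 1≤1+r (begin
      c * closed v * (1# + r)    ≈⟨ solve 3 (λ c m k → c :* m :* k := c :* k :* m) ≈-refl c (closed v) (1# + r) ⟩
      c * (1# + r) * closed v    ≈⟨ *-congʳ (÷-cancelʳ r 1+r≉0) ⟩
      r * closed v               ≈⟨ distribˡ r (mass v) (near v) ⟩
      r * mass v + r * near v    ≤⟨ +-mono-≤ safe ≤-refl ⟩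
      near v + r * near v        ≈⟨ solve 2 (λ a r → a :+ r :* a := a :* (con 1 :+ r)) ≈-refl (near v) r ⟩
      near v * (1# + r)          ∎)

    ≈closed+far : ∀ x v → x * closed v + far v * x ≈ x
    ≈closed+far x v = begin-equality
      x * closed v + far v * x  ≈⟨ solve 3 (λ x m q → x :* m :+ q :* x := x :* (m :+ q)) ≈-refl x (closed v) (far v) ⟩
      x * (closed v + far v)    ≈⟨ *-congˡ (closed+far≈1 v) ⟩
      x * 1#                    ≈⟨ *-identityʳ x ⟩
      x                         ∎

    -- On a `move`, a decisive hop wins with share at least `c`, and otherwise induction applies. At
    -- a `stay`, `advance` changes nothing, so `value-step` bounds `V` in terms of itself:
    -- `near v ≤ V * closed v`, and the nonzero `closed v` cancels.
    c≤value : ∀ {v} {w : Walk v} → SafeWalk w → c ≤ value (v , w)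
    c≤value {v} (stay safe live) = *-cancelʳ-≤-nonNeg (closed-nonNeg v) live (begin
      c * closed v  ≤⟨ c*closed≤near safe ⟩
      near v        ≤⟨ +-cancelˡ-≤ (far v * V) (begin
        far v * V + near v        ≈⟨ +-comm _ _ ⟩
        near v + far v * V        ≤⟨ value-step (v , stay) ⟩
        V                         ≈⟨ ≈closed+far V v ⟨
        V * closed v + far v * V  ≈⟨ +-comm _ _ ⟩
        far v * V + V * closed v  ∎) ⟩
      V * closed v  ∎)
      where V = value (v , stay)
    c≤value {v} {move e w} (move safe rest) = begin
      c                           ≈⟨ ≈closed+far c v ⟨
      c * closed v + far v * c    ≤⟨ +-mono-≤ (c*closed≤near safe) (*-monoʳ-≤ (far v) (far-nonNeg v) (c≤value rest)) ⟩
      near v + far v * value (_ , w)  ≤⟨ value-step (v , move e w) ⟩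
      value (v , move e w)        ∎

    massless-safe : ∀ {v} → mass v ≈ 0# → Safe v
    massless-safe {v} m≈0 = begin
      r * mass v  ≈⟨ trans (*-congˡ m≈0) (zeroʳ r) ⟩
      0#          ≤⟨ near-nonNeg v ⟩
      near v      ∎

    -- As long as the closed neighbourhoods along the way carry no mass, the next vertex has
    -- mass 0 and hence is safe.
    safeWalk : ∀ {v z} → Safe v → ¬ mass z ≈ 0# → Star Adj v z → ∃ λ (w : Walk v) → SafeWalk w
    safeWalk {v} safe z≉0 path with closed v ≈? 0#
    ... | no live = stay , stay safe live
    safeWalk {v} safe z≉0 ε | yes closed≈0 = ⊥-elim (z≉0 (antisym
      (≤-trans (x≤x+y (mass v) (near-nonNeg v)) (≤-reflexive closed≈0)) (mass-nonNeg v)))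
    safeWalk {v} safe z≉0 (_◅_ {j = u} e path) | yes closed≈0 =
      let w , w-safe = safeWalk (massless-safe u≈0) z≉0 path in move e w , move safe w-safe
      where
      u≈0 : mass u ≈ 0#
      u≈0 = antisym (begin
        mass u           ≤⟨ mass≤near e ⟩
        near v           ≤⟨ x≤x+y (near v) (mass-nonNeg v) ⟩
        near v + mass v  ≈⟨ +-comm _ _ ⟩
        closed v         ≈⟨ closed≈0 ⟩
        0#               ∎) (mass-nonNeg u)

    safe-near : ∀ s → r * r ≈ fromℕ (degree s) → ∃ λ g → ReflClosure Adj s g × Safe g
    safe-near s r²≈deg with any? (λ w → adjacent? s w ×-dec (r * mass w ≤? mass s))
    -- By symmetry `s` is a neighbour of `w`, so the mass of `s` alone makes `w` safe.
    ... | yes (w , e , rw≤s) = w , [ e ] , ≤-trans rw≤s (mass≤near (symmetric e))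
    ... | no none = s , refl , s-safe
      where
      term : ∀ k → (if does (adjacent? s k) then mass s else 0#) ≤ r * nearMass s k
      term k with adjacent? s k
      ... | no  _ = ≤-reflexive (sym (zeroʳ r))
      ... | yes e with total (mass s) (r * mass k)
      ...   | inj₁ s≤rk = s≤rk
      ...   | inj₂ rk≤s = ⊥-elim (none (k , e , rk≤s))
      s-safe : Safe s
      -- Summing `term` over the `r * r` neighbours carries an extra factor `r`, which cancels only
      -- when nonzero; for `r ≈ 0#` safety is immediate.
      s-safe with r ≈? 0#
      ... | yes r≈0 = begin
        r * mass s  ≈⟨ trans (*-congʳ r≈0) (zeroˡ _) ⟩
        0#          ≤⟨ near-nonNeg s ⟩
        near s      ∎
      ... | no r≉0 = *-cancelʳ-≤-nonNeg 0≤r r≉0 (begin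
        r * mass s * r              ≈⟨ solve 2 (λ r m → r :* m :* r := r :* r :* m) ≈-refl r (mass s) ⟩
        r * r * mass s              ≈⟨ *-congʳ r²≈deg ⟩
        fromℕ (degree s) * mass s   ≈⟨ fromℕ-length-filter (adjacent? s) id (mass s) ⟩
        sum (λ k → if does (adjacent? s k) then mass s else 0#)  ≤⟨ sum-mono-≤ term ⟩
        sum (λ k → r * nearMass s k)  ≈⟨ *-distribˡ-sum r (nearMass s) ⟨
        r * near s                  ≈⟨ *-comm r (near s) ⟩
        near s * r                  ∎)

    -- The step from `s` to the safe vertex `g` is made on turn 1, before any hop, so `s` itself
    -- need not be safe.
    hunt-wins : ∀ s → r * r ≈ fromℕ (degree s) → (∀ u v → Star Adj u v) →
      ∃ λ (σ : Strategy s) → r ÷ (1# + r) ≤ winProbability p σ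
    hunt-wins s r²≈deg connected =
      let g , first , g-safe = safe-near s r²≈deg
          z , z≉0            = massive-vertex
          w , w-safe         = safeWalk g-safe z≉0 (connected g z)
      in hunt first w , ≤-trans (c≤value w-safe) (value≤winProbability first w)

-- The bound for a start of maximum degree, chosen before the distribution.

lemma12 : (R : CompleteOrderedField) (G : Graph) →
    let open CompleteOrderedField R
        open Graph G
        open Game R G
        d = fromℕ maxDegree
    in Connected →
       ∃ λ (start : Vertex) → ∀ (p : Distribution) →
         ∃ λ (σ : Strategy start) → √ d ÷ (1# + √ d) ≤ winProbability p σ
lemma12 R G (v , connected) =
  let s , degree≡ = maxDegree-attained G v
      0≤d = fromℕ-nonNeg maxDegree
  in s , λ p → Hunt.hunt-wins R G p (√ (fromℕ maxDegree)) (√-nonNeg 0≤d) s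
       (trans (√-square 0≤d) (reflexive (≡.cong fromℕ (≡.sym degree≡)))) connected
  where
  open CompleteOrderedField R
  open OrderedFieldProperties R
  open OrderedField R
  open Graph G
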